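{- Let $G$ be a finite simple graph of order $p$, and let $\mathbb{F}$ be a field with $\operatorname{char}\mathbb{F}\neq 2$ such that either $\operatorname{char}\mathbb{F}=0$ or $p<2+\operatorname{char}\mathbb{F}$. Then a linear functional $\lambda$ on $U_G$ is a short functional if and only if there exist an edge $[a,b]$ of $G$ and a nonzero scalar $\alpha\in\mathbb{F}$ such that $\lambda(a)=\lambda(b)=\alpha$ and $\lambda(c)=0$ for every vertex $c\notin\{a,b\}$.
   Context: $G$ has vertex set $VG$ and edge set $EG$; the edge with endpoints $x,y$ is written $[x,y]$, and $x\sim y$ means $x,y$ are adjacent. $U_G$ denotes the $\mathbb{F}$-vector space with basis $VG$ (formal linear combinations of vertices). A short functional is a nonzero linear functional $\lambda$ on $U_G$ satisfying: (1) if $x\neq y$ are nonadjacent vertices, then $\lambda(x)=0$ or $\lambda(y)=0$; (2) if $\lambda(x)\neq 0$, then $\lambda(x)=\sum_{t\sim x}\lambda(t)$, the sum over the vertices $t$ adjacent to $x$. (These are exactly the functionals $\lambda$ for which, with $\mu([x,y])=\lambda(x)\lambda(y)$ on edges, the map $u+\mathfrak{z}\mapsto\lambda(u)r+\mu(\mathfrak{z})\mathfrak{s}$ is a homomorphism of the normal graph algebra of $G$ into the algebra with basis $r,\mathfrak{s}$ and sole nonzero product $r^2=\mathfrak{s}$.) -}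

module Defs where

open import Algebra.Apartness using (HeytingField; HeytingCommutativeRing)
open import Algebra.Bundles using (CommutativeRing)
open import Algebra.Module.Bundles using (Module)
open import Algebra.Module.Construct.TensorUnit using (⟨module⟩)
open import Algebra.Module.Morphism.Structures using (module ModuleMorphisms)
open import Data.Bool.Base using (if_then_else_)
open import Data.Fin.Base using (Fin)
open import Data.Fin.Properties using (_≟_)
open import Data.Nat.Base using (ℕ)
open import Data.Nat.Divisibility using (_∣_)
open import Data.Product.Base using (∃; _,_)
open import Data.Sum.Base using (_⊎_)
open import Data.Vec.Functional using (Vector)
open import Function.Bundles using (_⇔_)
open import Level using (Level; _⊔_; suc)
open import Relation.Binary.Core using (Rel)
open import Relation.Binary.Definitions using (Decidable; Irreflexive; Symmetric)
open import Relation.Binary.PropositionalEquality.Core using (_≡_; _≢_)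
open import Relation.Nullary.Decidable.Core using (does)
open import Relation.Nullary.Negation.Core using (¬_)

-- A simple graph of order p; its vertex set is Fin p and [ x , y ] is an
-- edge exactly when x ∼ y.
record SimpleGraph (e : Level) (p : ℕ) : Set (suc e) where
  infix 4 _∼_ _∼?_
  field
    _∼_      : Rel (Fin p) e
    ∼-sym    : Symmetric _∼_
    ∼-irrefl : Irreflexive _≡_ _∼_
    _∼?_     : Decidable _∼_

-- Fields are Heyting fields, and "nonzero" is read as x # 0#.  Since the
-- apartness is tight, classically x # y is the same as ¬ (x ≈ y), and
-- classically every field is a Heyting field in exactly one way.
module _ {c ℓ₁ ℓ₂ : Level} (F : HeytingField c ℓ₁ ℓ₂) where

  open HeytingField F using (heytingCommutativeRing)

  private
    R : CommutativeRing c ℓ₁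
    R = HeytingCommutativeRing.commutativeRing heytingCommutativeRing

  open CommutativeRing R
  open import Algebra.Definitions.RawMonoid +-rawMonoid using (_×_)

  -- n generates the kernel of ℤ → F; characteristic zero is n = 0, because
  -- 0 ∣ m only for m = 0.
  HasCharacteristic : ℕ → Set ℓ₁
  HasCharacteristic n = ∀ m → (m × 1# ≈ 0#) ⇔ (n ∣ m)

  -- The space U of formal linear combinations of p vertices, given by their
  -- coefficients.
  U : (p : ℕ) → Module R c ℓ₁
  U p = record
    { Carrierᴹ = Vector Carrier p
    ; _≈ᴹ_     = λ u v → ∀ i → u i ≈ v i
    ; _+ᴹ_     = λ u v i → u i + v i
    ; _*ₗ_     = λ a u i → a * u i
    ; _*ᵣ_     = λ u a i → u i * a
    ; 0ᴹ       = λ _ → 0#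
    ; -ᴹ_      = λ u i → - u i
    ; isModule = record
      { isBimodule = record
        { isBisemimodule = record
          { +ᴹ-isCommutativeMonoid = record
            { isMonoid = record
              { isSemigroup = record
                { isMagma = record
                  { isEquivalence = record
                    { refl  = λ _ → refl
                    ; sym   = λ u≈v i → sym (u≈v i)
                    ; trans = λ u≈v v≈w i → trans (u≈v i) (v≈w i)
                    }
                  ; ∙-cong = λ u≈u′ v≈v′ i → +-cong (u≈u′ i) (v≈v′ i)
                  }
                ; assoc = λ u v w i → +-assoc (u i) (v i) (w i)
                }
              ; identity = (λ u i → +-identityˡ (u i)) , (λ u i → +-identityʳ (u i))
              }
            ; comm = λ u v i → +-comm (u i) (v i)
            }
          ; isPreleftSemimodule = record
            { *ₗ-cong      = λ a≈b u≈v i → *-cong a≈b (u≈v i)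
            ; *ₗ-zeroˡ     = λ u i → zeroˡ (u i)
            ; *ₗ-distribʳ  = λ u a b i → distribʳ (u i) a b
            ; *ₗ-identityˡ = λ u i → *-identityˡ (u i)
            ; *ₗ-assoc     = λ a b u i → *-assoc a b (u i)
            ; *ₗ-zeroʳ     = λ a i → zeroʳ a
            ; *ₗ-distribˡ  = λ a u v i → distribˡ a (u i) (v i)
            }
          ; isPrerightSemimodule = record
            { *ᵣ-cong      = λ u≈v a≈b i → *-cong (u≈v i) a≈b
            ; *ᵣ-zeroʳ     = λ u i → zeroʳ (u i)
            ; *ᵣ-distribˡ  = λ u a b i → distribˡ (u i) a b
            ; *ᵣ-identityʳ = λ u i → *-identityʳ (u i)
            ; *ᵣ-assoc     = λ u a b i → *-assoc (u i) a b
            ; *ᵣ-zeroˡ     = λ a i → zeroˡ a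
            ; *ᵣ-distribʳ  = λ a u v i → distribʳ a (u i) (v i)
            }
          ; *ₗ-*ᵣ-assoc = λ a u b i → *-assoc a (u i) b
          }
        ; -ᴹ‿cong    = λ u≈v i → -‿cong (u≈v i)
        ; -ᴹ‿inverse = (λ u i → -‿inverseˡ (u i)) , (λ u i → -‿inverseʳ (u i))
        }
      ; *ₗ-*ᵣ-coincident = λ a u i → *-comm a (u i)
      }
    }

  record LinearFunctional (p : ℕ) : Set (c ⊔ ℓ₁) where
    open ModuleMorphisms (Module.rawModule (U p)) (Module.rawModule (⟨module⟩ {R = R}))
    field
      ⟦_⟧                  : Vector Carrier p → Carrier
      isModuleHomomorphism : IsModuleHomomorphism ⟦_⟧

  vertex : ∀ {p} → Fin p → Vector Carrier p
  vertex x y = if does (x ≟ y) then 1# else 0#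

module _ {c ℓ₁ ℓ₂ : Level} {F : HeytingField c ℓ₁ ℓ₂} where

  open HeytingField F using (Carrier; _≈_; _#_; 0#; heytingCommutativeRing)
  open HeytingCommutativeRing heytingCommutativeRing using (commutativeRing)
  open CommutativeRing commutativeRing using (+-rawMonoid)
  open import Algebra.Definitions.RawMonoid +-rawMonoid using (sum)

  -- The value of a functional at a vertex, viewed as a basis vector of U.
  infixl 9 _at_
  _at_ : ∀ {p} → LinearFunctional F p → Fin p → Carrier
  φ at x = LinearFunctional.⟦_⟧ φ (vertex F x)

  record IsShortFunctional {e p} (G : SimpleGraph e p) (φ : LinearFunctional F p)
                           : Set (c ⊔ ℓ₁ ⊔ ℓ₂ ⊔ e) where
    open SimpleGraph G
    open LinearFunctional φ using (⟦_⟧)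
    field
      nonzero     : ∃ λ u → ⟦ u ⟧ # 0#
      nonadjacent : ∀ x y → x ≢ y → ¬ (x ∼ y) → (φ at x ≈ 0#) ⊎ (φ at y ≈ 0#)
      neighbours  : ∀ x → φ at x # 0# →
                    φ at x ≈ sum (λ t → if does (t ∼? x) then φ at t else 0#)

{-# OPTIONS --safe #-}

-- Let s be the sum of λ over all vertices.  If λ(x) ≠ 0, then λ vanishes at
-- every vertex other than x and its neighbours, so condition (2) reads
-- 2 λ(x) = s.  As 2 ≠ 0, λ takes a single value α on its support, and if the
-- support has k elements then k α = s = 2 α, so k ≡ 2 modulo the
-- characteristic.  Since k ≤ p this forces k = 2, and the two vertices are
-- adjacent by condition (1).
--
-- No decidability of the field is needed.  One vertex x with λ(x) # 0 exists,
-- and any other y satisfies λ(y) # 0 or λ(y) # λ(x); in the second case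
-- λ(y) # 0 would contradict λ(y) = λ(x), so λ(y) = 0 by tightness.
module Submission where

open import Algebra.Apartness using (HeytingField; HeytingCommutativeRing)
open import Algebra.Bundles using (CommutativeRing)
open import Algebra.Module.Bundles using (Module)
open import Algebra.Module.Construct.TensorUnit using (⟨module⟩)
open import Algebra.Module.Morphism.Structures using (module ModuleMorphisms)
import Algebra.Apartness.Properties.HeytingCommutativeRing as HeytingProperties
import Algebra.Properties.CommutativeMonoid.Sum as Sum
import Algebra.Properties.Ring as RingProperties
import Algebra.Properties.Semiring.Mult as Mult
open import Data.Bool.Base using (if_then_else_)
open import Data.Empty using (⊥-elim)
open import Data.Fin.Base using (Fin; zero; suc)
open import Data.Fin.Properties using (_≟_; punchInᵢ≢i)
open import Data.List.Base using ([]; _∷_; length; filter; allFin; tabulate)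
open import Data.List.Membership.Propositional using (_∈_)
open import Data.List.Membership.Propositional.Properties using (∈-filter⁺; ∈-filter⁻; ∈-allFin)
open import Data.List.Properties using (length-filter; length-tabulate)
open import Data.List.Relation.Unary.All using ([]; _∷_)
open import Data.List.Relation.Unary.AllPairs using ([]; _∷_)
open import Data.List.Relation.Unary.Any using (here; there)
open import Data.List.Relation.Unary.Unique.Propositional using (Unique)
open import Data.List.Relation.Unary.Unique.Propositional.Properties using (allFin⁺; filter⁺)
open import Data.Nat.Base using (ℕ; zero; suc; _+_; _<_; _≤_)
open import Data.Nat.Divisibility using (_∣_; ∣⇒≤; 0∣⇒≡0; ∣-refl)
open import Data.Nat.Primality using (prime⇒irreducible; prime[2])
open import Data.Nat.Properties using (<⇒≱; ≤-reflexive; ≤-trans; ≤-<-trans; +-cancelˡ-<)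
open import Data.Product.Base using (∃; ∃₂; _×_; _,_; proj₁; proj₂)
open import Data.Sum.Base using (_⊎_; inj₁; inj₂; [_,_]′)
open import Data.Vec.Functional using (Vector; replicate)
open import Function.Base using (id; _∘_)
open import Function.Bundles using (_⇔_; mk⇔; Equivalence)
open import Level using (Level)
open import Relation.Binary.PropositionalEquality.Core as ≡ using (_≡_; _≢_)
import Relation.Binary.Reasoning.Setoid as ≈-Reasoning
open import Relation.Nullary.Decidable.Core using (yes; no; does)
open import Relation.Nullary.Negation.Core using (¬_; contradiction)
open import Relation.Unary using (Pred; Decidable)
open import Defs

∣∧<⇒≡0 : ∀ {q m} → q ∣ m → m < q → m ≡ 0
∣∧<⇒≡0 {m = zero}  _   _   = ≡.refl
∣∧<⇒≡0 {m = suc _} q∣m m<q = contradiction (∣⇒≤ q∣m) (<⇒≱ m<q)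

module _ {ℓ n} {P : Pred (Fin n) ℓ} (P? : Decidable P) where

  count≤n : length (filter P? (allFin n)) ≤ n
  count≤n = ≤-trans (length-filter P? (allFin n)) (≤-reflexive (length-tabulate id))

  count≡2⇒pair : length (filter P? (allFin n)) ≡ 2 →
    ∃₂ λ a b → a ≢ b × P a × P b × (∀ x → x ≢ a → x ≢ b → ¬ P x)
  count≡2⇒pair = go (filter P? (allFin n)) (filter⁺ P? (allFin⁺ n))
    (proj₂ ∘ ∈-filter⁻ P? {xs = allFin n}) (∈-filter⁺ P? (∈-allFin _))
    where
    go : ∀ xs → Unique xs → (∀ {x} → x ∈ xs → P x) → (∀ {x} → P x → x ∈ xs) →
         length xs ≡ 2 → ∃₂ λ a b → a ≢ b × P a × P b × (∀ x → x ≢ a → x ≢ b → ¬ P x)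
    go (a ∷ b ∷ []) ((a≢b ∷ []) ∷ _) sound complete ≡.refl =
      a , b , a≢b , sound (here ≡.refl) , sound (there (here ≡.refl)) , others
      where
      others : ∀ x → x ≢ a → x ≢ b → ¬ P x
      others x x≢a x≢b Px with complete Px
      ... | here x≡a         = x≢a x≡a
      ... | there (here x≡b) = x≢b x≡b

module Field {c ℓ₁ ℓ₂} (F : HeytingField c ℓ₁ ℓ₂) where

  open HeytingField F using (_#_; #-cotrans; #-irrefl; #⇒invertible; tight; heytingCommutativeRing) public
  open HeytingProperties heytingCommutativeRing public
  open HeytingCommutativeRing heytingCommutativeRing using (commutativeRing) public
  open CommutativeRing commutativeRing hiding (zero) renaming (_+_ to _⊕_) public
  open Sum +-commutativeMonoid public
  open RingProperties ring using (-‿distribʳ-*; +-cancelˡ; x≈y⇒x∙y⁻¹≈ε) public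
  open Mult semiring using (×-assoc-*; ×-congʳ; ×-homo-1) renaming (_×_ to _·_) public
  open ≈-Reasoning setoid public

  *-noninjective⇒≈0 : ∀ {x y z} → x # y → z * x ≈ z * y → z ≈ 0#
  *-noninjective⇒≈0 {x} {y} {z} x#y zx≈zy with d⁻¹ , _ , dd⁻¹≈1 ← #⇒invertible x#y = begin
    z                       ≈⟨ *-identityʳ z ⟨
    z * 1#                  ≈⟨ *-congˡ dd⁻¹≈1 ⟨
    z * ((x - y) * d⁻¹)     ≈⟨ *-assoc z (x - y) d⁻¹ ⟨
    (z * (x - y)) * d⁻¹     ≈⟨ *-congʳ (distribˡ z x (- y)) ⟩
    (z * x ⊕ z * - y) * d⁻¹ ≈⟨ *-congʳ (+-congˡ (-‿distribʳ-* z y)) ⟨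
    (z * x - z * y) * d⁻¹   ≈⟨ *-congʳ (x≈y⇒x∙y⁻¹≈ε zx≈zy) ⟩
    0# * d⁻¹                ≈⟨ zeroˡ d⁻¹ ⟩
    0#                      ∎

  *#0⇒#0 : ∀ {x y} → x * y # 0# → y # 0#
  *#0⇒#0 {x} {y} xy#0 with i , i[xy-0]≈1 , _ ← #⇒invertible xy#0 = invertibleˡ⇒# (i * x , (begin
    i * x * (y - 0#)   ≈⟨ *-congˡ (x-0≈x y) ⟩
    i * x * y          ≈⟨ *-assoc i x y ⟩
    i * (x * y)        ≈⟨ *-congˡ (x-0≈x (x * y)) ⟨
    i * (x * y - 0#)   ≈⟨ i[xy-0]≈1 ⟩
    1#                 ∎))

  x+y#y⇒x#0 : ∀ {x y} → x ⊕ y # y → x # 0#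
  x+y#y⇒x#0 {x} {y} x+y#y with i , i[x+y-y]≈1 , _ ← #⇒invertible x+y#y = invertibleˡ⇒# (i , (begin
    i * (x - 0#)         ≈⟨ *-congˡ (trans (x-0≈x x) (sym (trans (+-congˡ (-‿inverseʳ y)) (+-identityʳ x)))) ⟩
    i * (x ⊕ (y - y))    ≈⟨ *-congˡ (+-assoc x y (- y)) ⟨
    i * (x ⊕ y - y)      ≈⟨ i[x+y-y]≈1 ⟩
    1#                   ∎))

  sum#0⇒∃#0 : ∀ {n} (f : Vector Carrier n) → sum f # 0# → ∃ λ i → f i # 0#
  sum#0⇒∃#0 {zero}  f 0#0 = ⊥-elim (#-irrefl refl 0#0)
  sum#0⇒∃#0 {suc n} f s#0 with #-cotrans s#0 (sum (f ∘ suc))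
  ... | inj₁ s#tail = zero , x+y#y⇒x#0 s#tail
  ... | inj₂ tail#0 with i , fᵢ#0 ← sum#0⇒∃#0 (f ∘ suc) tail#0 = suc i , fᵢ#0

  sum-update : ∀ {n} (f g : Vector Carrier n) i → f i ≈ 0# →
               (∀ j → j ≢ i → f j ≈ g j) → g i ⊕ sum f ≈ sum g
  sum-update {suc n} f g i fᵢ≈0 f≈g = begin
    g i ⊕ sum f         ≈⟨ +-congˡ (sum-remove {i = i} f) ⟩
    g i ⊕ (f i ⊕ _)     ≈⟨ +-congˡ (+-congʳ fᵢ≈0) ⟩
    g i ⊕ (0# ⊕ _)      ≈⟨ +-congˡ (+-identityˡ _) ⟩
    g i ⊕ _             ≈⟨ +-congˡ (sum-cong-≋ (λ j → f≈g _ (punchInᵢ≢i i j))) ⟩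
    g i ⊕ _             ≈⟨ sum-remove {i = i} g ⟨
    sum g               ∎

  sum-single : ∀ {n} (f : Vector Carrier n) i → (∀ j → j ≢ i → f j ≈ 0#) → sum f ≈ f i
  sum-single {n} f i f≈0 = begin
    sum f                          ≈⟨ sum-update (replicate n 0#) f i refl (λ j j≢i → sym (f≈0 j j≢i)) ⟨
    f i ⊕ sum (replicate n 0#)     ≈⟨ +-congˡ (sum-replicate-zero n) ⟩
    f i ⊕ 0#                       ≈⟨ +-identityʳ (f i) ⟩
    f i                            ∎

  sum-two-valued : ∀ {a ℓ n} {A : Set a} {P : Pred A ℓ} (P? : Decidable P) (g : A → Carrier) {α} →
    (∀ x → P x → g x ≈ α) → (∀ x → ¬ P x → g x ≈ 0#) →
    (f : Fin n → A) → sum (g ∘ f) ≈ length (filter P? (tabulate f)) · α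
  sum-two-valued {n = zero}  P? g P⇒α ¬P⇒0 f = refl
  sum-two-valued {n = suc n} P? g P⇒α ¬P⇒0 f with P? (f zero)
  ... | yes p = +-cong (P⇒α _ p) (sum-two-valued P? g P⇒α ¬P⇒0 (f ∘ suc))
  ... | no ¬p = trans (+-congʳ (¬P⇒0 _ ¬p))
                  (trans (+-identityˡ _) (sum-two-valued P? g P⇒α ¬P⇒0 (f ∘ suc)))

  module _ {q} (char : HasCharacteristic F q) where

    ·-noninjective⇒∣ : ∀ {x y} n → x # y → n · x ≈ n · y → q ∣ n
    ·-noninjective⇒∣ {x} {y} n x#y nx≈ny =
      Equivalence.to (char n) (*-noninjective⇒≈0 x#y (begin
        (n · 1#) * x ≈⟨ n·1*z≈n·z x ⟩
        n · x        ≈⟨ nx≈ny ⟩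
        n · y        ≈⟨ n·1*z≈n·z y ⟨
        (n · 1#) * y ∎))
      where
      n·1*z≈n·z : ∀ z → (n · 1#) * z ≈ n · z
      n·1*z≈n·z z = trans (×-assoc-* n 1# z) (×-congʳ n (*-identityˡ z))

    char≢1 : q ≢ 1
    char≢1 ≡.refl =
      #-irrefl (trans (sym (×-homo-1 1#)) (Equivalence.from (char 1) ∣-refl)) 1#0

    char∤2 : q ≢ 2 → ¬ (q ∣ 2)
    char∤2 q≢2 q∣2 = [ char≢1 , q≢2 ]′ (prime⇒irreducible prime[2] q∣2)

  vertex-refl : ∀ {p} (x : Fin p) → vertex F x x ≈ 1#
  vertex-refl x with x ≟ x
  ... | yes _  = refl
  ... | no x≢x = contradiction ≡.refl x≢x

  vertex-≢ : ∀ {p} {x y : Fin p} → x ≢ y → vertex F x y ≈ 0#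
  vertex-≢ {x = x} {y} x≢y with x ≟ y
  ... | yes x≡y = contradiction x≡y x≢y
  ... | no _    = refl

  module _ {p} (φ : LinearFunctional F p) where

    open LinearFunctional φ
    open ModuleMorphisms (Module.rawModule (U F p)) (Module.rawModule (⟨module⟩ {R = commutativeRing}))
    open IsModuleHomomorphism isModuleHomomorphism

    ⟦⟧-∑ : ∀ {n} (v : Fin n → Vector Carrier p) →
           ⟦ (λ j → ∑[ i < n ] v i j) ⟧ ≈ ∑[ i < n ] ⟦ v i ⟧
    ⟦⟧-∑ {zero}  v = 0ᴹ-homo
    ⟦⟧-∑ {suc n} v = trans (+ᴹ-homo _ _) (+-congˡ (⟦⟧-∑ (v ∘ suc)))

    ⟦⟧-expand : ∀ u → ⟦ u ⟧ ≈ ∑[ x < p ] (u x * φ at x)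
    ⟦⟧-expand u = begin
      ⟦ u ⟧                                        ≈⟨ ⟦⟧-cong (λ y → sym (coordinate y)) ⟩
      ⟦ (λ y → ∑[ x < p ] (u x * vertex F x y)) ⟧  ≈⟨ ⟦⟧-∑ (λ x y → u x * vertex F x y) ⟩
      ∑[ x < p ] ⟦ (λ y → u x * vertex F x y) ⟧    ≈⟨ sum-cong-≋ (λ x → *ₗ-homo (u x) (vertex F x)) ⟩
      ∑[ x < p ] (u x * φ at x)                    ∎
      where
      coordinate : ∀ y → ∑[ x < p ] (u x * vertex F x y) ≈ u y
      coordinate y = begin
        ∑[ x < p ] (u x * vertex F x y) ≈⟨ sum-single _ y (λ x x≢y → trans (*-congˡ (vertex-≢ x≢y)) (zeroʳ (u x))) ⟩
        u y * vertex F y y              ≈⟨ *-congˡ (vertex-refl y) ⟩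
        u y * 1#                        ≈⟨ *-identityʳ (u y) ⟩
        u y                             ∎

    nonzero⇒nonzero-vertex : ∀ u → ⟦ u ⟧ # 0# → ∃ λ x → φ at x # 0#
    nonzero⇒nonzero-vertex u ⟦u⟧#0
      with x , uφ#0 ← sum#0⇒∃#0 _ (#-congʳ (⟦⟧-expand u) ⟦u⟧#0) = x , *#0⇒#0 uφ#0

module Graph {c ℓ₁ ℓ₂ e} (F : HeytingField c ℓ₁ ℓ₂) {p} (G : SimpleGraph e p)
             (φ : LinearFunctional F p) where

  open Field F
  open SimpleGraph G

  EdgeSupported : Set _
  EdgeSupported = ∃₂ λ a b → (a ∼ b) × (∃ λ α → (α # 0#) × (φ at a ≈ α) × (φ at b ≈ α) ×
    (∀ x → x ≢ a → x ≢ b → φ at x ≈ 0#))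

  neighbourValue : Fin p → Fin p → Carrier
  neighbourValue x t = if does (t ∼? x) then φ at t else 0#

  neighbourValue-self : ∀ x → neighbourValue x x ≈ 0#
  neighbourValue-self x with x ∼? x
  ... | yes x∼x = contradiction x∼x (∼-irrefl ≡.refl)
  ... | no _    = refl

  neighbourValue-∼ : ∀ {x t} → t ∼ x → neighbourValue x t ≈ φ at t
  neighbourValue-∼ {x} {t} t∼x with t ∼? x
  ... | yes _  = refl
  ... | no t≁x = contradiction t∼x t≁x

  neighbourValue-≈0 : ∀ {x t} → φ at t ≈ 0# → neighbourValue x t ≈ 0#
  neighbourValue-≈0 {x} {t} φt≈0 with t ∼? x
  ... | yes _ = φt≈0
  ... | no _  = refl

  module Short (short : IsShortFunctional G φ) {q} (char : HasCharacteristic F q) (q≢2 : q ≢ 2) where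

    open IsShortFunctional short

    total : Carrier
    total = ∑[ t < p ] (φ at t)

    neighbourValue-≢ : ∀ x → φ at x # 0# → ∀ t → t ≢ x → neighbourValue x t ≈ φ at t
    neighbourValue-≢ x φx#0 t t≢x with t ∼? x
    ... | yes _  = refl
    ... | no t≁x with nonadjacent t x t≢x t≁x
    ...   | inj₁ φt≈0 = sym φt≈0
    ...   | inj₂ φx≈0 = contradiction φx#0 (#-irrefl φx≈0)

    double≈total : ∀ x → φ at x # 0# → 2 · φ at x ≈ total
    double≈total x φx#0 = begin
      φ at x ⊕ (φ at x ⊕ 0#)           ≈⟨ +-congˡ (×-homo-1 (φ at x)) ⟩
      φ at x ⊕ φ at x                  ≈⟨ +-congˡ (neighbours x φx#0) ⟩
      φ at x ⊕ sum (neighbourValue x)  ≈⟨ sum-update _ _ x (neighbourValue-self x) (neighbourValue-≢ x φx#0) ⟩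
      total                            ∎

    constant-on-support : ∀ x y → φ at x # 0# → φ at y # 0# → φ at x ≈ φ at y
    constant-on-support x y φx#0 φy#0 = proj₁ (tight _ _) λ φx#φy →
      char∤2 char q≢2 (·-noninjective⇒∣ char 2 φx#φy
        (trans (double≈total x φx#0) (sym (double≈total y φy#0))))

    module Support x₀ (φx₀#0 : φ at x₀ # 0#) where

      α : Carrier
      α = φ at x₀

      support? : Decidable (λ y → φ at y # 0#)
      support? y with #-cotrans φx₀#0 (φ at y)
      ... | inj₁ φx₀#φy = no λ φy#0 → #-irrefl (constant-on-support x₀ y φx₀#0 φy#0) φx₀#φy
      ... | inj₂ φy#0   = yes φy#0

      zero-off-support : ∀ y → ¬ (φ at y # 0#) → φ at y ≈ 0#
      zero-off-support y = proj₁ (tight _ _)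

      k : ℕ
      k = length (filter support? (allFin p))

      k·α≈2·α : k · α ≈ 2 · α
      k·α≈2·α = begin
        k · α ≈⟨ sum-two-valued support? (φ at_) (λ y φy#0 → constant-on-support y x₀ φy#0 φx₀#0) zero-off-support id ⟨
        total ≈⟨ double≈total x₀ φx₀#0 ⟨
        2 · α ∎

      k≡2 : (q ≡ 0) ⊎ (p < 2 + q) → k ≡ 2
      k≡2 = small k (count≤n support?) k·α≈2·α
        where
        small : ∀ k → k ≤ p → k · α ≈ 2 · α → (q ≡ 0) ⊎ (p < 2 + q) → k ≡ 2
        small 0 _ 0≈2α _ = contradiction
          (·-noninjective⇒∣ char 2 φx₀#0 (trans (sym 0≈2α) (sym (trans (+-identityˡ _) (+-identityˡ _)))))
          (char∤2 char q≢2)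
        small 1 _ α≈2α _ = contradiction φx₀#0
          (#-irrefl (trans (sym (×-homo-1 α)) (sym (+-cancelˡ α _ _ α≈2α))))
        small (suc (suc m)) 2+m≤p kα≈2α bound = ≡.cong (2 +_) (m≡0 bound)
          where
          q∣m : q ∣ m
          q∣m = ·-noninjective⇒∣ char m φx₀#0 (begin
            m · α  ≈⟨ +-cancelˡ α _ _ (+-cancelˡ α _ _ kα≈2α) ⟩
            0#     ≈⟨ sum-replicate-zero m ⟨
            sum (replicate m 0#) ≈⟨ sum-replicate m ⟩
            m · 0# ∎)
          m≡0 : (q ≡ 0) ⊎ (p < 2 + q) → m ≡ 0
          m≡0 (inj₁ ≡.refl) = 0∣⇒≡0 q∣m
          m≡0 (inj₂ p<2+q)  = ∣∧<⇒≡0 q∣m (+-cancelˡ-< 2 _ _ (≤-<-trans 2+m≤p p<2+q))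

      edgeSupported : (q ≡ 0) ⊎ (p < 2 + q) → EdgeSupported
      edgeSupported bound with count≡2⇒pair support? (k≡2 bound)
      ... | a , b , a≢b , φa#0 , φb#0 , others =
        a , b , a∼b , α , φx₀#0 , constant-on-support a x₀ φa#0 φx₀#0 , constant-on-support b x₀ φb#0 φx₀#0 ,
        λ x x≢a x≢b → zero-off-support x (others x x≢a x≢b)
        where
        a∼b : a ∼ b
        a∼b with a ∼? b
        ... | yes a∼b = a∼b
        ... | no a≁b with nonadjacent a b a≢b a≁b
        ...   | inj₁ φa≈0 = contradiction φa#0 (#-irrefl φa≈0)
        ...   | inj₂ φb≈0 = contradiction φb#0 (#-irrefl φb≈0)

  short⇒edgeSupported : ∀ {q} → HasCharacteristic F q → q ≢ 2 → (q ≡ 0) ⊎ (p < 2 + q) →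
                        IsShortFunctional G φ → EdgeSupported
  short⇒edgeSupported char q≢2 bound short
    with u , ⟦u⟧#0 ← IsShortFunctional.nonzero short
    with x₀ , φx₀#0 ← nonzero⇒nonzero-vertex φ u ⟦u⟧#0
    = Short.Support.edgeSupported short char q≢2 x₀ φx₀#0 bound

  edgeSupported⇒short : EdgeSupported → IsShortFunctional G φ
  edgeSupported⇒short (a , b , a∼b , α , α#0 , φa≈α , φb≈α , others) = record
    { nonzero     = vertex F a , #-congʳ (sym φa≈α) α#0
    ; nonadjacent = nonadjacent
    ; neighbours  = neighbours
    }
    where
    endpoint? : ∀ x → (x ≡ a ⊎ x ≡ b) ⊎ φ at x ≈ 0#
    endpoint? x with x ≟ a | x ≟ b
    ... | yes x≡a | _       = inj₁ (inj₁ x≡a)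
    ... | no _    | yes x≡b = inj₁ (inj₂ x≡b)
    ... | no x≢a  | no x≢b  = inj₂ (others x x≢a x≢b)

    nonadjacent : ∀ x y → x ≢ y → ¬ (x ∼ y) → (φ at x ≈ 0#) ⊎ (φ at y ≈ 0#)
    nonadjacent x y x≢y x≁y with endpoint? x | endpoint? y
    ... | inj₂ φx≈0           | _                   = inj₁ φx≈0
    ... | inj₁ _              | inj₂ φy≈0           = inj₂ φy≈0
    ... | inj₁ (inj₁ ≡.refl) | inj₁ (inj₁ ≡.refl) = contradiction ≡.refl x≢y
    ... | inj₁ (inj₁ ≡.refl) | inj₁ (inj₂ ≡.refl) = contradiction a∼b x≁y
    ... | inj₁ (inj₂ ≡.refl) | inj₁ (inj₁ ≡.refl) = contradiction (∼-sym a∼b) x≁y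
    ... | inj₁ (inj₂ ≡.refl) | inj₁ (inj₂ ≡.refl) = contradiction ≡.refl x≢y

    neighbour-sum : ∀ {x y} → y ∼ x → (∀ t → t ≢ x → t ≢ y → φ at t ≈ 0#) →
                    sum (neighbourValue x) ≈ φ at y
    neighbour-sum {x} {y} y∼x zero-elsewhere =
      trans (sum-single (neighbourValue x) y only-y) (neighbourValue-∼ y∼x)
      where
      only-y : ∀ t → t ≢ y → neighbourValue x t ≈ 0#
      only-y t t≢y with t ≟ x
      ... | yes ≡.refl = neighbourValue-self x
      ... | no t≢x     = neighbourValue-≈0 (zero-elsewhere t t≢x t≢y)

    neighbours : ∀ x → φ at x # 0# → φ at x ≈ sum (neighbourValue x)
    neighbours x φx#0 with endpoint? x
    ... | inj₂ φx≈0          = contradiction φx#0 (#-irrefl φx≈0)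
    ... | inj₁ (inj₁ ≡.refl) =
      trans φa≈α (trans (sym φb≈α) (sym (neighbour-sum (∼-sym a∼b) others)))
    ... | inj₁ (inj₂ ≡.refl) =
      trans φb≈α (trans (sym φa≈α) (sym (neighbour-sum a∼b (λ t t≢b t≢a → others t t≢a t≢b))))

theorem4p1 : ∀ {c ℓ₁ ℓ₂ e : Level} (F : HeytingField c ℓ₁ ℓ₂) (p : ℕ) (G : SimpleGraph e p) →
    (q : ℕ) → HasCharacteristic F q → q ≢ 2 → (q ≡ 0) ⊎ (p < 2 + q) →
    (φ : LinearFunctional F p) →
    let open HeytingField F
        open SimpleGraph G in
    IsShortFunctional G φ ⇔
      (∃₂ λ a b → (a ∼ b) × (∃ λ α → (α # 0#) × (φ at a ≈ α) × (φ at b ≈ α) ×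
        (∀ x → x ≢ a → x ≢ b → φ at x ≈ 0#)))
theorem4p1 F p G q char q≢2 bound φ =
  mk⇔ (short⇒edgeSupported char q≢2 bound) edgeSupported⇒short
  where open Graph F G φ
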